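{- Let $D$ be a loopless graph on $n$ vertices with set of sources $S$, and let $q \ge 2$ denote an integer. Then: (i) $\mathrm{s}[D^\circ, q] = n - \sigma(D)$ for all $q \ge n - |S|$; (ii) $\mathrm{i}[D^\circ, q] = n$ for all $q \ge 3$.
   Context: Graphs are finite and directed: $D=(V,E)$ with $V=\{1,\dots,n\}$, $n\ge 1$, $E\subseteq V^2$. A loop is an arc $(v,v)$; $D$ is loopless if it has no loops. For loopless $D$, $D^\circ$ is the graph obtained from $D$ by adding a loop on every vertex. The in-neighbourhood of $v$ in a graph $H$ is $N(v;H)=\{u : (u,v)\in E(H)\}$. A source of $D$ is a vertex with empty in-neighbourhood in $D$. With $S$ the set of sources of $D$, $$\sigma(D) := \max\{ |U| : U\subseteq V\setminus S,\ N(u;D^\circ)\cap N(v;D^\circ)=\emptyset \text{ for all } u,v\in U,\ u\neq v\}.$$ For an integer $q\ge 2$ let $[q]=\{0,\dots,q-1\}$. For $f=(f_1,\dots,f_n):[q]^n\to[q]^n$, the interaction graph $G(f)$ has vertex set $V$ and an arc $(u,v)$ if and only if there exist $x,y\in[q]^n$ differing only in coordinate $u$ with $f_v(x)\ne f_v(y)$. For a graph $H$ on $V$, $\mathrm{F}[H,q]$ is the set of all $f:[q]^n\to[q]^n$ with $G(f)=H$. Let $d_{\mathrm H}$ be the Hamming distance, $\mathrm{s}(f)=\min_{x\in[q]^n}(n-d_{\mathrm H}(x,f(x)))$ and $\mathrm{i}(f)=\min_{x\in[q]^n}d_{\mathrm H}(x,f(x))$. Finally $\mathrm{s}[H,q]=\max_{f\in\mathrm{F}[H,q]}\mathrm{s}(f)$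 and $\mathrm{i}[H,q]=\max_{f\in\mathrm{F}[H,q]}\mathrm{i}(f)$. -}

module Defs where

open import Level using (0ℓ)
open import Data.Nat using (ℕ; zero; suc; _∸_; _≤_)
open import Data.Fin using (Fin; _≟_)
open import Data.Fin.Properties using (all?)
open import Data.Fin.Subset using (Subset; inside; outside; ∣_∣; ∁; _⊆_; _∈_)
open import Data.Fin.Subset.Properties using (_∈?_; _⊆?_)
open import Data.List using (List; []; _∷_; map; filter; allFin; cartesianProductWith)
open import Data.List.Extrema.Nat using (max; min)
open import Data.List.Membership.Propositional as List using (lose)
open import Data.List.Membership.Propositional.Properties
  using (∈-cartesianProductWith⁺; ∈-allFin)
open import Data.List.Relation.Unary.Any as Any using (here; satisfied)
open import Data.Product using (_×_; _,_; ∃; ∃-syntax)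
open import Data.Sum using (_⊎_)
open import Data.Vec using (Vec; []; _∷_; lookup; tabulate; count; zip)
open import Relation.Binary using (Rel; Decidable; _⇔_)
open import Relation.Binary.PropositionalEquality using (_≡_; _≢_; refl)
open import Relation.Nullary using (¬_; Dec; does; ¬?; _×-dec_; _⊎-dec_; _→-dec_)
open import Relation.Nullary.Decidable using (map′)
open import Relation.Unary as Unary using (Pred; Empty; _∩_)

private
  variable
    n q : ℕ
    A : Set

-- The arc set is a decidable subset of V × V, where V = Fin n.
record Graph (n : ℕ) : Set₁ where
  field
    Arc  : Rel (Fin n) 0ℓ
    arc? : Decidable Arc

open Graph public

Loopless : Graph n → Set
Loopless D = ∀ v → ¬ Arc D v v

infix 8 _°
_° : Graph n → Graph n
Arc  (D °) u v = Arc D u v ⊎ u ≡ v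
arc? (D °) u v = arc? D u v ⊎-dec u ≟ v

N : Fin n → Graph n → Pred (Fin n) 0ℓ
N v H u = Arc H u v

Source : Graph n → Pred (Fin n) 0ℓ
Source D v = Empty (N v D)

source? : (D : Graph n) → Unary.Decidable (Source D)
source? D v = all? (λ u → ¬? (arc? D u v))

sources : Graph n → Subset n
sources D = tabulate (λ v → does (source? D v))

vectors : List A → (n : ℕ) → List (Vec A n)
vectors xs zero    = [] ∷ []
vectors xs (suc n) = cartesianProductWith _∷_ xs (vectors xs n)

∈-vectors : {xs : List A} → (∀ a → a List.∈ xs) → (v : Vec A n) → v List.∈ vectors xs n
∈-vectors all∈ []      = here refl
∈-vectors all∈ (a ∷ v) = ∈-cartesianProductWith⁺ _∷_ (all∈ a) (∈-vectors all∈ v)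

subsets : (n : ℕ) → List (Subset n)
subsets = vectors (inside ∷ outside ∷ [])

Admissible : Graph n → Pred (Subset n) 0ℓ
Admissible D U =
  U ⊆ ∁ (sources D) ×
  (∀ u v → u ∈ U → v ∈ U → u ≢ v → Empty (N u (D °) ∩ N v (D °)))

admissible? : (D : Graph n) → Unary.Decidable (Admissible D)
admissible? D U =
  (U ⊆? ∁ (sources D)) ×-dec
  all? λ u → all? λ v → (u ∈? U) →-dec ((v ∈? U) →-dec (¬? (u ≟ v) →-dec
    all? λ w → ¬? (arc? (D °) w u ×-dec arc? (D °) w v)))

-- The default 0 does not affect the maximum: the empty set is admissible.
σ : Graph n → ℕ
σ {n} D = max 0 (map ∣_∣ (filter (admissible? D) (subsets n)))

-- [q]ⁿ. Vectors rather than functions Fin n → Fin q, so that every map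
-- out of it respects pointwise equality of configurations.
Config : ℕ → ℕ → Set
Config q n = Vec (Fin q) n

configs : (q n : ℕ) → List (Config q n)
configs q = vectors (allFin q)

DifferOnlyAt : Fin n → Rel (Config q n) 0ℓ
DifferOnlyAt u x y =
  lookup x u ≢ lookup y u × (∀ w → w ≢ u → lookup x w ≡ lookup y w)

Influences : (Config q n → Config q n) → Rel (Fin n) 0ℓ
Influences f u v =
  ∃[ x ] ∃[ y ] DifferOnlyAt u x y × lookup (f x) v ≢ lookup (f y) v

∃config? : {P : Pred (Config q n) 0ℓ} → Unary.Decidable P → Dec (∃ P)
∃config? P? =
  map′ satisfied (λ (x , px) → lose (∈-vectors ∈-allFin x) px) (Any.any? P? (configs _ _))

influences? : (f : Config q n → Config q n) → Decidable (Influences f)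
influences? f u v = ∃config? λ x → ∃config? λ y →
  (¬? (lookup x u ≟ lookup y u) ×-dec
    all? λ w → ¬? (w ≟ u) →-dec (lookup x w ≟ lookup y w))
  ×-dec ¬? (lookup (f x) v ≟ lookup (f y) v)

G : (Config q n → Config q n) → Graph n
Arc  (G f) = Influences f
arc? (G f) = influences? f

F[_,_] : Graph n → (q : ℕ) → Pred (Config q n → Config q n) 0ℓ
F[ H , q ] f = Arc (G f) ⇔ Arc H

d-H : Config q n → Config q n → ℕ
d-H x y = count (λ (a , b) → ¬? (a ≟ b)) (zip x y)

-- In s and i the default n does not affect the minimum: no entry exceeds n.
s : (Config q n → Config q n) → ℕ
s {q} {n} f = min n (map (λ x → n ∸ d-H x (f x)) (configs q n))

i : (Config q n → Config q n) → ℕ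
i {q} {n} f = min n (map (λ x → d-H x (f x)) (configs q n))

-- "k is the maximum of g over P", including that it is attained
-- (so it is false for every k when P is empty).
IsMax : {B : Set} → Pred B 0ℓ → (B → ℕ) → ℕ → Set
IsMax P g k = (∃[ b ] P b × g b ≡ k) × (∀ b → P b → g b ≤ k)

infix 4 s[_,_]≡_ i[_,_]≡_

s[_,_]≡_ : Graph n → ℕ → ℕ → Set
s[ H , q ]≡ k = IsMax F[ H , q ] s k

i[_,_]≡_ : Graph n → ℕ → ℕ → Set
i[ H , q ]≡ k = IsMax F[ H , q ] i k

{-# OPTIONS --safe #-}

-- Upper bound in (i): every non-source u has an in-neighbour other than
-- itself, so x_u ≠ f_u(x) for some x; when the closed in-neighbourhoods of the
-- u ∈ U are disjoint, these x can be glued into one that moves all of U.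
-- Lower bound in (i): give the non-sources distinct colours c(v) ∈ [q] and let
-- f_v change x_v exactly when all of N(v;D°) has the value c(v). Two vertices
-- that change simultaneously then cannot share a closed in-neighbour.
-- For (ii), f_v applies to x_v one of two fixed-point-free maps of [q],
-- selected by whether all of N(v;D) has the value 0.
module Submission where

open import Defs
open import Level using (0ℓ)
open import Data.Bool using (Bool; true; false; if_then_else_)
open import Data.Fin using (Fin; zero; suc; _≟_; inject≤)
open import Data.Fin.Properties using (all?; any?; ¬∀⟶∃¬; inject≤-injective; suc-injective)
open import Data.Fin.Subset using (Subset; inside; outside; ∣_∣; ∁; _∈_)
open import Data.Fin.Subset.Properties
  using (_∈?_; p⊆q⇒∣p∣≤∣q∣; ∣p∣≤n; x∈∁p⇒x∉p; x∉p⇒x∈∁p; ∣∁p∣≡n∸∣p∣)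
open import Data.List using ([]; _∷_; map)
open import Data.List.Extrema.Nat using (min≤v⁺; v≤min⁺; max≤v⁺; v≤max⁺)
open import Data.List.Membership.Propositional as List using (lose)
open import Data.List.Membership.Propositional.Properties using (∈-map⁺; ∈-filter⁺; ∈-allFin)
open import Data.List.Relation.Unary.All as All using (universal)
open import Data.List.Relation.Unary.All.Properties using (map⁺; all-filter)
open import Data.List.Relation.Unary.Any using (here; there)
open import Data.Nat using (ℕ; zero; suc; NonZero; _∸_; _≤_; _≥_; z≤n; s≤s)
open import Data.Nat.Properties
  using (≤-refl; ≤-trans; ≤-reflexive; ≤-antisym; m∸n≤m; m∸[m∸n]≡n; ∸-monoʳ-≤)
open import Data.Product using (_×_; _,_; proj₁; proj₂; ∃-syntax)
open import Data.Sum using (inj₁; inj₂)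
open import Data.Vec using ([]; _∷_; lookup; tabulate; replicate; zipWith; _[_]≔_; here; there)
open import Data.Vec.Properties
  using ( lookup∘tabulate; lookup∘update; lookup∘update′; lookup-replicate; lookup-zipWith
        ; lookup⇒[]=; []=⇒lookup)
open import Function using (_∘_)
open import Relation.Binary.PropositionalEquality
  using (_≡_; _≢_; refl; sym; trans; cong; subst₂; ≢-sym)
open import Relation.Nullary using (¬_; Dec; yes; no; does; ¬?; _×-dec_; _→-dec_; contradiction)
open import Relation.Nullary.Decidable using (dec-true; dec-false; decidable-stable)
open import Relation.Unary using (Pred; Empty; _∩_)

private
  variable
    n q m : ℕ

-- Decided conditionals and truncated subtraction.

if-yes : {A P : Set} (P? : Dec P) {a b : A} → P → (if does P? then a else b) ≡ a
if-yes P? p = cong (if_then _ else _) (dec-true P? p)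

if-no : {A P : Set} (P? : Dec P) {a b : A} → ¬ P → (if does P? then a else b) ≡ b
if-no P? ¬p = cong (if_then _ else _) (dec-false P? ¬p)

if-cong : {A P Q : Set} (P? : Dec P) (Q? : Dec Q) {a a′ b b′ : A} → (P → Q) → (Q → P) →
  a ≡ a′ → b ≡ b′ → (if does P? then a else b) ≡ (if does Q? then a′ else b′)
if-cong (yes p) Q? P⇒Q _   a≡a′ _    = trans a≡a′ (sym (if-yes Q? (P⇒Q p)))
if-cong (no ¬p) Q? _   Q⇒P _    b≡b′ = trans b≡b′ (sym (if-no Q? (¬p ∘ Q⇒P)))

if-both : {A : Set} (R : A → Set) (t : Bool) {a b : A} → R a → R b → R (if t then a else b)
if-both R true  Ra _  = Ra
if-both R false _  Rb = Rb

-- Lets a bound `n ∸ ∣ U ∣` on `s f` be read as a bound on `∣ U ∣`, and be turned back after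
-- maximising over `U`.
m≤n∸o⇒o≤n∸m : ∀ {m n o} → o ≤ n → m ≤ n ∸ o → o ≤ n ∸ m
m≤n∸o⇒o≤n∸m {m} {n} o≤n m≤n∸o =
  ≤-trans (≤-reflexive (sym (m∸[m∸n]≡n o≤n))) (∸-monoʳ-≤ n m≤n∸o)

-- Injective colourings of a subset.

index : {p : Subset n} {v : Fin n} → v ∈ p → Fin ∣ p ∣
index                   here        = zero
index {p = inside  ∷ p} (there v∈p) = suc (index v∈p)
index {p = outside ∷ p} (there v∈p) = index v∈p

index-injective : {p : Subset n} {u v : Fin n} (u∈p : u ∈ p) (v∈p : v ∈ p) →
                  index u∈p ≡ index v∈p → u ≡ v
index-injective                   here        here        _  = refl
index-injective {p = inside  ∷ p} (there u∈p) (there v∈p) eq =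
  cong suc (index-injective u∈p v∈p (suc-injective eq))
index-injective {p = outside ∷ p} (there u∈p) (there v∈p) eq =
  cong suc (index-injective u∈p v∈p eq)

injectiveColouring : (p : Subset n) → ∣ p ∣ ≤ suc q →
  ∃[ c ] (∀ {u v : Fin n} → u ∈ p → v ∈ p → c u ≡ c v → u ≡ v)
injectiveColouring {n} {q} p ∣p∣≤ = colour , injective
  where
  colour : Fin n → Fin (suc q)
  colour v with v ∈? p
  ... | yes v∈p = inject≤ (index v∈p) ∣p∣≤
  -- Off `p` any colour will do; the palette `Fin (suc q)` guarantees that one exists.
  ... | no  _   = zero

  injective : ∀ {u v} → u ∈ p → v ∈ p → colour u ≡ colour v → u ≡ v
  injective {u} {v} u∈p v∈p eq with u ∈? p | v ∈? p
  ... | yes u∈p′ | yes v∈p′ = index-injective u∈p′ v∈p′ (inject≤-injective ∣p∣≤ ∣p∣≤ _ _ eq)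
  ... | no  u∉p  | _        = contradiction u∈p u∉p
  ... | yes _    | no v∉p   = contradiction v∈p v∉p

-- Hamming distance as the size of a difference set.

diff : Config q n → Config q n → Subset n
diff = zipWith (λ a b → does (¬? (a ≟ b)))

d-H≡∣diff∣ : (x y : Config q n) → d-H x y ≡ ∣ diff x y ∣
d-H≡∣diff∣ []      []      = refl
d-H≡∣diff∣ (a ∷ x) (b ∷ y) with does (a ≟ b)
... | true  = d-H≡∣diff∣ x y
... | false = cong suc (d-H≡∣diff∣ x y)

∈-diff⁺ : (x y : Config q n) {v : Fin n} → lookup x v ≢ lookup y v → v ∈ diff x y
∈-diff⁺ x y {v} ne =
  lookup⇒[]= v _ (trans (lookup-zipWith _ v x y) (dec-true (¬? (lookup x v ≟ lookup y v)) ne))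

∈-diff⁻ : (x y : Config q n) {v : Fin n} → v ∈ diff x y → lookup x v ≢ lookup y v
∈-diff⁻ x y {v} v∈ eq
  with () ← trans (sym ([]=⇒lookup v∈))
                  (trans (lookup-zipWith _ v x y)
                         (dec-false (¬? (lookup x v ≟ lookup y v)) (λ ne → ne eq)))

∣p∣≤d-H : (p : Subset n) (x y : Config q n) →
          (∀ {v} → v ∈ p → lookup x v ≢ lookup y v) → ∣ p ∣ ≤ d-H x y
∣p∣≤d-H p x y moved =
  ≤-trans (p⊆q⇒∣p∣≤∣q∣ (∈-diff⁺ x y ∘ moved)) (≤-reflexive (sym (d-H≡∣diff∣ x y)))

n≤d-H : (x y : Config q n) → (∀ v → lookup x v ≢ lookup y v) → n ≤ d-H x y
n≤d-H []      []      ne = z≤n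
n≤d-H (a ∷ x) (b ∷ y) ne rewrite dec-false (a ≟ b) (ne zero) = s≤s (n≤d-H x y (ne ∘ suc))

-- Bounds on `s`, `i` and `σ`.

s≤ : (f : Config q n → Config q n) (x : Config q n) → s f ≤ n ∸ d-H x (f x)
s≤ {q} {n} f x = min≤v⁺ n (map (λ x → n ∸ d-H x (f x)) (configs q n))
  (inj₂ (lose (∈-map⁺ _ (∈-vectors ∈-allFin x)) ≤-refl))

s≤n : (f : Config q n → Config q n) → s f ≤ n
s≤n {q} {n} f = min≤v⁺ n (map (λ x → n ∸ d-H x (f x)) (configs q n)) (inj₁ ≤-refl)

≤s : {k : ℕ} (f : Config q n → Config q n) → k ≤ n → (∀ x → k ≤ n ∸ d-H x (f x)) → k ≤ s f
≤s {q} {n} f k≤n k≤ = v≤min⁺ {xs = map (λ x → n ∸ d-H x (f x)) (configs q n)} k≤n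
  (map⁺ (universal k≤ _))

i≤n : (f : Config q n → Config q n) → i f ≤ n
i≤n {q} {n} f = min≤v⁺ n (map (λ x → d-H x (f x)) (configs q n)) (inj₁ ≤-refl)

n≤i : (f : Config q n → Config q n) → (∀ x → n ≤ d-H x (f x)) → n ≤ i f
n≤i {q} {n} f n≤ = v≤min⁺ {xs = map (λ x → d-H x (f x)) (configs q n)} ≤-refl
  (map⁺ (universal n≤ _))

σ≤ : (D : Graph n) {k : ℕ} → (∀ U → Admissible D U → ∣ U ∣ ≤ k) → σ D ≤ k
σ≤ D bound = max≤v⁺ z≤n
  (map⁺ (All.map (λ {U} → bound U) (all-filter (admissible? D) (subsets _))))

≤σ : (D : Graph n) {U : Subset n} → Admissible D U → ∣ U ∣ ≤ σ D
≤σ D {U} adm = v≤max⁺ 0 _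
  (inj₂ (lose (∈-map⁺ ∣_∣ (∈-filter⁺ (admissible? D) (∈-vectors ∈-sides U) adm)) ≤-refl))
  where
  ∈-sides : ∀ a → a List.∈ (inside ∷ outside ∷ [])
  ∈-sides true  = here refl
  ∈-sides false = there (here refl)

-- Arcs and non-sources.

arc⇒≢ : {D : Graph n} → Loopless D → {u v : Fin n} → Arc D u v → u ≢ v
arc⇒≢ loopless uv refl = loopless _ uv

∈-∁sources⁺ : (D : Graph n) {u v : Fin n} → Arc D u v → v ∈ ∁ (sources D)
∈-∁sources⁺ D {u} {v} uv = x∉p⇒x∈∁p λ v∈ → contradiction
  (trans (sym ([]=⇒lookup v∈))
    (trans (lookup∘tabulate _ v) (dec-false (source? D v) (λ src → src u uv))))
  λ ()

∈-∁sources⁻ : (D : Graph n) {v : Fin n} → v ∈ ∁ (sources D) → ∃[ u ] Arc D u v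
∈-∁sources⁻ {n} D {v} v∈ =
  let u , ¬¬uv = ¬∀⟶∃¬ n _ (λ u → ¬? (arc? D u v)) λ src →
        x∈∁p⇒x∉p v∈ (lookup⇒[]= v _ (trans (lookup∘tabulate _ v) (dec-true (source? D v) src)))
  in u , decidable-stable (arc? D u v) ¬¬uv

-- Dependence of local functions and interaction graphs.

-- `Influences f u v` unfolds to `Depends (λ y → lookup (f y) v) u`. A codomain free of the
-- dimension `n` permits induction on `n`.
Depends : (Config q n → Fin m) → Pred (Fin n) 0ℓ
Depends g u = ∃[ x ] ∃[ y ] DifferOnlyAt u x y × g x ≢ g y

-- Turn `x` into `y` one coordinate at a time, from the head on. A step that changed the value would
-- exhibit a dependence at its coordinate; but there `x` and `y` agree, so the step changes nothing.
agreeOnDepends⇒≡ : (g : Config q n → Fin m) (x y : Config q n) →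
  (∀ u → Depends g u → lookup x u ≡ lookup y u) → g x ≡ g y
agreeOnDepends⇒≡ g []      []      _     = refl
agreeOnDepends⇒≡ g (a ∷ x) (b ∷ y) agree =
  trans changeHead (agreeOnDepends⇒≡ (g ∘ (b ∷_)) x y agreeOnTail)
  where
  changeHead : g (a ∷ x) ≡ g (b ∷ x)
  changeHead with a ≟ b
  ... | yes refl = refl
  ... | no  a≢b  = decidable-stable (g (a ∷ x) ≟ g (b ∷ x)) λ ne →
    a≢b (agree zero (a ∷ x , b ∷ x ,
      (a≢b , λ { zero 0≢0 → contradiction refl 0≢0 ; (suc _) _ → refl }) , ne))

  agreeOnTail : ∀ u → Depends (g ∘ (b ∷_)) u → lookup x u ≡ lookup y u
  agreeOnTail u (x′ , y′ , (ne , eq) , gne) = agree (suc u) (b ∷ x′ , b ∷ y′ ,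
    (ne , λ { zero _ → refl ; (suc w) w≢u → eq w (w≢u ∘ cong suc) }) , gne)

AgreeOn : Pred (Fin n) 0ℓ → Config q n → Config q n → Set
AgreeOn P x y = ∀ w → P w → lookup x w ≡ lookup y w

depends-on-update : (g : Config q n → Fin m) (x : Config q n) (u : Fin n) (a : Fin q) →
  lookup x u ≢ a → g x ≢ g (x [ u ]≔ a) → Depends g u
depends-on-update g x u a xᵤ≢a gne = x , x [ u ]≔ a ,
  ((λ eq → xᵤ≢a (trans eq (lookup∘update u x a))) , λ w w≢u → sym (lookup∘update′ w≢u x a)) , gne

-- Locality excludes further arcs: a change at a vertex outside the in-neighbourhood of `v` leaves
-- that neighbourhood untouched. The second hypothesis supplies the required arcs.
F-tabulate : (H : Graph n) (rule : Fin n → Config q n → Fin q) →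
  (∀ v x y → AgreeOn (N v H) x y → rule v x ≡ rule v y) →
  (∀ u v → Arc H u v → Depends (rule v) u) →
  F[ H , q ] (λ x → tabulate (λ v → rule v x))
F-tabulate H rule local depends = influences⇒arc , arc⇒influences
  where
  influences⇒arc : ∀ {u v} → Influences (λ x → tabulate (λ w → rule w x)) u v → Arc H u v
  influences⇒arc {u} {v} (x , y , (_ , eq) , ne) = decidable-stable (arc? H u v) λ ¬uv →
    ne (trans (lookup∘tabulate _ v) (trans
      (local v x y λ w wv → eq w λ { refl → ¬uv wv })
      (sym (lookup∘tabulate _ v))))

  arc⇒influences : ∀ {u v} → Arc H u v → Influences (λ x → tabulate (λ w → rule w x)) u v
  arc⇒influences {u} {v} uv = let x , y , d , ne = depends u v uv in
    x , y , d , λ eq → ne (trans (sym (lookup∘tabulate _ v)) (trans eq (lookup∘tabulate _ v)))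

-- Uniform in-neighbourhoods.

-- Over `D °` the condition includes the value at `v` itself; over a loopless `D` it does not, and
-- at a source of `D` it holds vacuously.
Uniform : Graph n → Fin n → Fin q → Config q n → Set
Uniform H v c x = ∀ w → Arc H w v → lookup x w ≡ c

uniform? : (H : Graph n) (v : Fin n) (c : Fin q) (x : Config q n) → Dec (Uniform H v c x)
uniform? H v c x = all? λ w → arc? H w v →-dec (lookup x w ≟ c)

uniform-resp : (H : Graph n) (v : Fin n) (c : Fin q) {x y : Config q n} →
  AgreeOn (N v H) x y → Uniform H v c x → Uniform H v c y
uniform-resp H v c agree unif w wv = trans (sym (agree w wv)) (unif w wv)

-- The upper bound on `s`.

-- The two configurations that witness the influence agree at `u`. If `f` fixed coordinate `u` in
-- both, their images would agree there too.
influenced⇒moves : (f : Config q n → Config q n) {w u : Fin n} → w ≢ u → Influences f w u →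
  ∃[ x ] lookup x u ≢ lookup (f x) u
influenced⇒moves f {w} {u} w≢u (x , y , (_ , eq) , ne) with lookup x u ≟ lookup (f x) u
... | no  moved = x , moved
... | yes fixed = y , λ fixed′ → ne (trans (sym fixed) (trans (eq u (≢-sym w≢u)) fixed′))

-- By disjointness each vertex is an in-neighbour of at most one member of `U`, its owner, and takes
-- its value from the owner's configuration.
glue : (H : Graph n) (U : Subset n) →
  (∀ u v → u ∈ U → v ∈ U → u ≢ v → Empty (N u H ∩ N v H)) →
  (z : Fin n → Config q n) → ∃[ x ] (∀ {u} → u ∈ U → AgreeOn (N u H) x (z u))
glue {n} {q} H U disjoint z = tabulate pick , agrees
  where
  owner? : ∀ w → Dec (∃[ u ] (u ∈ U × Arc H w u))
  owner? w = any? λ u → (u ∈? U) ×-dec arc? H w u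

  pick : Fin n → Fin q
  pick w with owner? w
  ... | yes (u , _) = lookup (z u) w
  -- An unowned vertex is unconstrained; `z w` merely provides some element of `Fin q`.
  ... | no  _       = lookup (z w) w

  pick≡ : ∀ {u} → u ∈ U → ∀ w → Arc H w u → pick w ≡ lookup (z u) w
  pick≡ {u} u∈U w wu with owner? w
  ... | no  unowned = contradiction (u , u∈U , wu) unowned
  ... | yes (u′ , u′∈U , wu′) with u′ ≟ u
  ...   | yes refl = refl
  ...   | no  u′≢u = contradiction (wu′ , wu) (disjoint u′ u u′∈U u∈U u′≢u w)

  agrees : ∀ {u} → u ∈ U → AgreeOn (N u H) (tabulate pick) (z u)
  agrees u∈U w wu = trans (lookup∘tabulate pick w) (pick≡ u∈U w wu)

admissible⇒s≤ : (D : Graph n) → Loopless D → (f : Config (suc q) n → Config (suc q) n) →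
  F[ D ° , suc q ] f → {U : Subset n} → Admissible D U → s f ≤ n ∸ ∣ U ∣
admissible⇒s≤ {n} D loopless f (G⇒D° , D°⇒G) {U} (U⊆∁S , disjoint) =
  ≤-trans (s≤ f x) (∸-monoʳ-≤ n (∣p∣≤d-H U x (f x) moved))
  where
  mover : ∀ u → ∃[ z ] (u ∈ U → lookup z u ≢ lookup (f z) u)
  mover u with u ∈? U
  -- An arbitrary configuration, to make the choice total.
  ... | no  u∉U = replicate n zero , λ u∈U → contradiction u∈U u∉U
  ... | yes u∈U =
    let w , wu = ∈-∁sources⁻ D (U⊆∁S u∈U)
        z , ne = influenced⇒moves f (arc⇒≢ {D = D} loopless wu) (D°⇒G (inj₁ wu))
    in z , λ _ → ne

  glued = glue (D °) U disjoint (proj₁ ∘ mover)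
  x = proj₁ glued

  moved : ∀ {u} → u ∈ U → lookup x u ≢ lookup (f x) u
  -- `x` agrees with the witness for `u` on the whole closed in-neighbourhood of `u`. This contains
  -- `u`, by its loop, and every coordinate on which the value of `f` at `u` depends.
  moved {u} u∈U = subst₂ _≢_
    (sym (proj₂ glued u∈U u (inj₂ refl)))
    (sym (agreeOnDepends⇒≡ (λ y → lookup (f y) u) x (proj₁ (mover u))
      λ w infl → proj₂ glued u∈U w (G⇒D° infl)))
    (proj₂ (mover u) u∈U)

s≤n∸σ : (D : Graph n) → Loopless D → (f : Config (suc q) n → Config (suc q) n) →
  F[ D ° , suc q ] f → s f ≤ n ∸ σ D
s≤n∸σ {n} D loopless f f∈F = m≤n∸o⇒o≤n∸m (s≤n f)
  (σ≤ D λ U adm → m≤n∸o⇒o≤n∸m (∣p∣≤n U) (admissible⇒s≤ D loopless f f∈F adm))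

-- The lower bound on `s`.

-- Not an involution beyond two values: what matters is the absence of fixed points and, in
-- `Unstable`, also the values at 0 and 1.
flip : Fin (suc (suc q)) → Fin (suc (suc q))
flip zero    = suc zero
flip (suc _) = zero

flip≢ : (a : Fin (suc (suc q))) → flip a ≢ a
flip≢ zero    ()
flip≢ (suc _) ()

module Stable (D : Graph n) (loopless : Loopless D)
              (∣∁S∣≤q : ∣ ∁ (sources D) ∣ ≤ suc (suc q)) where

  c : Fin n → Fin (suc (suc q))
  c = proj₁ (injectiveColouring (∁ (sources D)) ∣∁S∣≤q)

  -- Sources are barred from moving, since admissible sets avoid them and `c` separates non-sources
  -- only.
  Moves : Fin n → Config (suc (suc q)) n → Set
  Moves v x = v ∈ ∁ (sources D) × Uniform (D °) v (c v) x

  moves? : ∀ v x → Dec (Moves v x)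
  moves? v x = (v ∈? ∁ (sources D)) ×-dec uniform? (D °) v (c v) x

  rule : Fin n → Config (suc (suc q)) n → Fin (suc (suc q))
  rule v x = if does (moves? v x) then flip (lookup x v) else lookup x v

  map-s : Config (suc (suc q)) n → Config (suc (suc q)) n
  map-s x = tabulate (λ v → rule v x)

  rule-local : ∀ v x y → AgreeOn (N v (D °)) x y → rule v x ≡ rule v y
  rule-local v x y agree = if-cong (moves? v x) (moves? v y)
    (λ { (v∈ , unif) → v∈ , uniform-resp (D °) v (c v) {x} {y} agree unif })
    (λ { (v∈ , unif) → v∈ , uniform-resp (D °) v (c v) {y} {x} (λ w → sym ∘ agree w) unif })
    (cong flip (agree v (inj₂ refl))) (agree v (inj₂ refl))

  -- In the constant configuration `c v`, vertex `v` moves to `flip (c v)`. Recolouring `u` alone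
  -- stops the move, and `v` keeps `c v` because `u` differs from `v`.
  depends-on-arc : ∀ u v → Arc D u v → Depends (rule v) u
  depends-on-arc u v uv =
    depends-on-update (rule v) x u (flip (c v)) xᵤ≢ λ eq →
      flip≢ (c v) (trans (sym rule-x) (trans eq rule-y))
    where
    x = replicate n (c v)
    y = x [ u ]≔ flip (c v)

    xᵤ≢ : lookup x u ≢ flip (c v)
    xᵤ≢ eq = flip≢ (c v) (trans (sym eq) (lookup-replicate u (c v)))

    rule-x : rule v x ≡ flip (c v)
    rule-x = trans
      (if-yes (moves? v x) (∈-∁sources⁺ D uv , λ w _ → lookup-replicate w (c v)))
      (cong flip (lookup-replicate v (c v)))

    rule-y : rule v y ≡ c v
    rule-y = trans
      (if-no (moves? v y) λ { (_ , unif) →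
        flip≢ (c v) (trans (sym (lookup∘update u x (flip (c v)))) (unif u (inj₁ uv))) })
      (trans (lookup∘update′ (≢-sym (arc⇒≢ {D = D} loopless uv)) x _) (lookup-replicate v (c v)))

  -- When all vertices other than `v` have value `flip (c v)`, `v` stays put: either it is a source
  -- or some in-neighbour has the wrong colour. The rule then returns the value at `v`, whatever it
  -- is.
  depends-on-self : ∀ v → Depends (rule v) v
  depends-on-self v =
    depends-on-update (rule v) x v (c v) (λ eq → flip≢ (c v) (trans (sym x≡) eq)) λ eq →
      flip≢ (c v) (trans (sym (trans (fixed x λ _ _ → refl) x≡))
        (trans eq (trans (fixed y λ w w≢v → lookup∘update′ w≢v x (c v)) (lookup∘update v x (c v)))))
    where
    x = replicate n (flip (c v))
    y = x [ v ]≔ c v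

    x≡ : lookup x v ≡ flip (c v)
    x≡ = lookup-replicate v (flip (c v))

    fixed : ∀ z → (∀ w → w ≢ v → lookup z w ≡ lookup x w) → rule v z ≡ lookup z v
    fixed z z≈x = if-no (moves? v z) λ { (v∈ , unif) →
      let w , wv = ∈-∁sources⁻ D v∈ in
      flip≢ (c v) (trans (sym (lookup-replicate w (flip (c v))))
        (trans (sym (z≈x w (arc⇒≢ {D = D} loopless wv))) (unif w (inj₁ wv)))) }

  map-s∈F : F[ D ° , suc (suc q) ] map-s
  map-s∈F = F-tabulate (D °) rule rule-local
    λ { u v (inj₁ uv) → depends-on-arc u v uv ; u .u (inj₂ refl) → depends-on-self u }

  moves : ∀ x {v} → v ∈ diff x (map-s x) → Moves v x
  moves x {v} v∈ = decidable-stable (moves? v x) λ ¬moves →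
    ∈-diff⁻ x (map-s x) v∈ (sym (trans (lookup∘tabulate _ v) (if-no (moves? v x) ¬moves)))

  -- A common closed in-neighbour would carry the colours of both moving vertices, and these are
  -- distinct.
  diff-admissible : ∀ x → Admissible D (diff x (map-s x))
  diff-admissible x = (λ v∈ → proj₁ (moves x v∈)) , λ u v u∈ v∈ u≢v w (wu , wv) →
    let u∈∁S , unif-u = moves x u∈
        v∈∁S , unif-v = moves x v∈
    in u≢v (proj₂ (injectiveColouring (∁ (sources D)) ∣∁S∣≤q) u∈∁S v∈∁S
             (trans (sym (unif-u w wu)) (unif-v w wv)))

  n∸σ≤s : n ∸ σ D ≤ s map-s
  n∸σ≤s = ≤s map-s (m∸n≤m n (σ D)) λ x → ∸-monoʳ-≤ n
    (≤-trans (≤-reflexive (d-H≡∣diff∣ x (map-s x))) (≤σ D (diff-admissible x)))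

-- A map that moves every coordinate of every configuration.

-- Its value at 0 must differ from both 0 and `flip zero`, hence the third value.
flip′ : Fin (suc (suc (suc q))) → Fin (suc (suc (suc q)))
flip′ zero          = suc (suc zero)
flip′ (suc zero)    = suc (suc zero)
flip′ (suc (suc _)) = suc zero

flip′≢ : (a : Fin (suc (suc (suc q)))) → flip′ a ≢ a
flip′≢ zero          ()
flip′≢ (suc zero)    ()
flip′≢ (suc (suc _)) ()

module Unstable (q : ℕ) (D : Graph n) (loopless : Loopless D) where

  zeros : Config (suc (suc (suc q))) n
  zeros = replicate n zero

  zeros≡ : ∀ w → lookup zeros w ≡ zero
  zeros≡ w = lookup-replicate w zero

  select? : ∀ v (x : Config (suc (suc (suc q))) n) → Dec (Uniform D v zero x)
  select? v x = uniform? D v zero x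

  rule : Fin n → Config (suc (suc (suc q))) n → Fin (suc (suc (suc q)))
  rule v x = if does (select? v x) then flip (lookup x v) else flip′ (lookup x v)

  map-i : Config (suc (suc (suc q))) n → Config (suc (suc (suc q))) n
  map-i x = tabulate (λ v → rule v x)

  rule-local : ∀ v x y → AgreeOn (N v (D °)) x y → rule v x ≡ rule v y
  rule-local v x y agree = if-cong (select? v x) (select? v y)
    (uniform-resp D v zero {x} {y} (λ w → agree w ∘ inj₁))
    (uniform-resp D v zero {y} {x} (λ w → sym ∘ agree w ∘ inj₁))
    (cong flip (agree v (inj₂ refl))) (cong flip′ (agree v (inj₂ refl)))

  rule-zeros : ∀ v → rule v zeros ≡ suc zero
  rule-zeros v = trans (if-yes (select? v zeros) (λ w _ → zeros≡ w)) (cong flip (zeros≡ v))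

  -- At `zeros` every rule gives `flip zero`, that is 1. Setting `u` to 1 breaks uniformity along an
  -- arc of `D`, giving `flip′ zero`, that is 2. For `u` equal to `v`, looplessness preserves
  -- uniformity and the result is `flip` of 1, that is 0.
  depends : ∀ u v → Arc (D °) u v → Depends (rule v) u
  depends u v arc = depends-on-update (rule v) zeros u (suc zero)
    (λ eq → contradiction (trans (sym (zeros≡ u)) eq) λ ())
    λ eq → rule-y≢ arc (trans (sym eq) (rule-zeros v))
    where
    y = zeros [ u ]≔ suc zero

    rule-y≢ : Arc (D °) u v → rule v y ≢ suc zero
    rule-y≢ (inj₁ uv) eq = contradiction (trans (sym eq) rule-y) λ ()
      where
      rule-y : rule v y ≡ suc (suc zero)
      rule-y = trans
        (if-no (select? v y) λ unif →
          contradiction (trans (sym (lookup∘update u zeros (suc zero))) (unif u uv)) λ ())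
        (cong flip′ (trans (lookup∘update′ (≢-sym (arc⇒≢ {D = D} loopless uv)) zeros _) (zeros≡ v)))
    rule-y≢ (inj₂ refl) eq = contradiction (trans (sym eq) rule-y) λ ()
      where
      rule-y : rule v y ≡ zero
      rule-y = trans
        (if-yes (select? v y) λ w wv →
          trans (lookup∘update′ (arc⇒≢ {D = D} loopless wv) zeros _) (zeros≡ w))
        (cong flip (lookup∘update v zeros (suc zero)))

  map-i∈F : F[ D ° , suc (suc (suc q)) ] map-i
  map-i∈F = F-tabulate (D °) rule rule-local depends

  rule≢ : ∀ v x → rule v x ≢ lookup x v
  rule≢ v x = if-both (_≢ lookup x v) (does (select? v x))
    (flip≢ (lookup x v)) (flip′≢ (lookup x v))

  n≤i-map : n ≤ i map-i
  n≤i-map = n≤i map-i λ x → n≤d-H x (map-i x) λ v eq →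
    rule≢ v x (trans (sym (lookup∘tabulate _ v)) (sym eq))

proposition3p1 : (n : ℕ) .{{_ : NonZero n}} (D : Graph n) → Loopless D →
    (∀ (q : ℕ) → q ≥ 2 → q ≥ n ∸ ∣ sources D ∣ → s[ D ° , q ]≡ (n ∸ σ D))
    × (∀ (q : ℕ) → q ≥ 2 → q ≥ 3 → i[ D ° , q ]≡ n)
proposition3p1 n D loopless = stable , unstable
  where
  stable : ∀ q → q ≥ 2 → q ≥ n ∸ ∣ sources D ∣ → s[ D ° , q ]≡ (n ∸ σ D)
  stable (suc (suc q)) _ q≥ =
    (map-s , map-s∈F , ≤-antisym (s≤n∸σ D loopless map-s map-s∈F) n∸σ≤s) , s≤n∸σ D loopless
    where
    -- There are `n ∸ ∣ sources D ∣` non-sources, so `q≥` provides enough colours.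
    open Stable {q = q} D loopless (≤-trans (≤-reflexive (∣∁p∣≡n∸∣p∣ (sources D))) q≥)
  stable (suc zero) (s≤s ())

  unstable : ∀ q → q ≥ 2 → q ≥ 3 → i[ D ° , q ]≡ n
  unstable (suc (suc (suc q))) _ _ =
    (map-i , map-i∈F , ≤-antisym (i≤n map-i) n≤i-map) , λ f _ → i≤n f
    where open Unstable q D loopless
  unstable (suc (suc zero)) _ (s≤s (s≤s ()))
  unstable (suc zero) (s≤s ())
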